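{- Every coherence space $A$ is a linear retract of the coherence space $\mathrm{flag}\,A$; that is, there exist linear morphisms $f_A: A\to \mathrm{flag}\,A$ and $t_A:\mathrm{flag}\,A\to A$ such that $t_A\circ f_A=\mathrm{Id}_A$ and $f_A\circ t_A\subset \mathrm{Id}_{\mathrm{flag}\,A}$ (inclusion of traces).
   Context: A coherence space $A$ is a set $|A|$ (its web, possibly infinite, whose elements are called tokens) endowed with a reflexive and symmetric binary relation on $|A|$, called coherence and written $\alpha\sim\alpha'\,[A]$. Strict coherence $\alpha\frown\alpha'\,[A]$ means $\alpha\sim\alpha'\,[A]$ and $\alpha\neq\alpha'$. A clique of $A$ is a set of pairwise coherent tokens. Linear morphisms from $A$ to $B$ are maps $F$ from cliques of $A$ to cliques of $B$ that are monotone for inclusion, commute with unions of families of pairwise compatible cliques (two cliques being compatible when their union is a clique), and satisfy $F(x\cap x')=F(x)\cap F(x')$ whenever $x\cup x'$ is a clique. They are in one-to-one correspondence with their traces $\{(\alpha,\beta)\mid \beta\in F(\{\alpha\})\}\subset|A|\times|B|$, which are exactly the cliques of the coherence space $A\multimap B$ with web $|A|\times|B|$ in which $(\alpha,\beta)\sim(\alpha',\beta')$ iff: ($\alpha\sim\alpha'\,[A]$ implies $\beta\sim\beta'\,[B]$) and ($\alpha\frown\alpha'\,[A]$ implies $\beta\frown\beta'\,[B]$). Composition of linear morphisms corresponds to relational composition of traces, and the identity $\mathrm{Id}_A$ has trace $\{(\alpha,\alpha)\mid\alpha\in|A|\}$. Linear morphisms are identified with their traces. Let $2^{\omega}$ be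 the set of infinite words on $\{0,1\}$, with the product topology (Cantor space) and the lexicographic total order: $w_1<w_2$ iff there are a finite word $m$ and infinite words $w_1',w_2'$ with $w_1=m0w_1'$ and $w_2=m1w_2'$. For a coherence space $A$, the coherence space $\mathrm{flag}\,A$ is defined as follows. Its web is the set of continuous functions from $2^\omega$ to $|A|$, where $|A|$ has the discrete topology. Two functions $f,g$ in this web are strictly coherent, $f\frown g\,[\mathrm{flag}\,A]$, iff there exists $w\in 2^\omega$ such that $f(w)\frown g(w)\,[A]$ and $f(w')=g(w')$ for all $w'<w$. -}

module Defs where

open import Data.Bool.Base using (Bool; true; false)
open import Data.Empty.Polymorphic using (⊥)
open import Data.List.Base using (List; []; _∷_)
open import Data.Nat.Base using (ℕ; zero; suc; _<_)
open import Data.Product.Base using (∃-syntax; _×_; _,_; proj₁; proj₂)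
open import Data.Product.Relation.Binary.Pointwise.NonDependent using (×-setoid)
open import Data.Sum.Base using (_⊎_; inj₁; inj₂)
open import Function.Base using (case_of_)
open import Function.Bundles using (Func; _⇔_; mk⇔)
open import Level using (Level) renaming (suc to lsuc)
open import Relation.Binary.Bundles using (Setoid)
open import Relation.Binary.Core using (Rel)
open import Relation.Binary.Definitions using (Reflexive; Symmetric; Decidable; _Respects_; _Respects₂_)
open import Relation.Binary.PropositionalEquality using (_≡_; _≗_; _→-setoid_)
open import Relation.Nullary.Decidable.Core using (yes; no)
open import Relation.Nullary.Negation.Core using (¬_; contradiction)
open import Relation.Unary using (Pred; _∈_; _⊆_; _≐_; _∩_; _∪_; ⋃)

private
  variable
    ℓ : Level

------------------------------------------------------------------------
-- Coherence spaces and cliques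

-- Webs are setoids, since the web of flag A consists of functions, whose
-- equality is extensional.

record CoherenceSpace (ℓ : Level) : Set (lsuc ℓ) where
  field
    web : Setoid ℓ ℓ

  open Setoid web public
    using (_≈_)
    renaming (Carrier to Token; refl to ≈-refl; sym to ≈-sym; trans to ≈-trans)

  field
    _∼_      : Rel Token ℓ
    ∼-refl   : Reflexive _∼_
    ∼-sym    : Symmetric _∼_
    ∼-resp-≈ : _∼_ Respects₂ _≈_

  _⌢_ : Rel Token ℓ
  α ⌢ α′ = α ∼ α′ × ¬ (α ≈ α′)

  ⌢-sym : Symmetric _⌢_
  ⌢-sym (c , ≉) = ∼-sym c , λ e → ≉ (≈-sym e)

  ∼-cong : ∀ {α α′ β β′} → α ≈ β → α′ ≈ β′ → α ∼ α′ → β ∼ β′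
  ∼-cong e e′ c = proj₁ ∼-resp-≈ e′ (proj₂ ∼-resp-≈ e c)

  ⌢-cong : ∀ {α α′ β β′} → α ≈ β → α′ ≈ β′ → α ⌢ α′ → β ⌢ β′
  ⌢-cong e e′ (c , ≉) =
    ∼-cong e e′ c , λ q → ≉ (≈-trans e (≈-trans q (≈-sym e′)))

∣_∣ : CoherenceSpace ℓ → Set ℓ
∣ A ∣ = CoherenceSpace.Token A

IsClique : (A : CoherenceSpace ℓ) → Pred ∣ A ∣ ℓ → Set ℓ
IsClique A x = ∀ {α α′} → α ∈ x → α′ ∈ x → α ∼ α′
  where open CoherenceSpace A

record Clique (A : CoherenceSpace ℓ) : Set (lsuc ℓ) where
  open CoherenceSpace A using (_≈_)
  field
    ⟦_⟧      : Pred ∣ A ∣ ℓ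
    resp     : ⟦_⟧ Respects _≈_
    coherent : IsClique A ⟦_⟧

open Clique public using (⟦_⟧)

Compatible : {A : CoherenceSpace ℓ} → Clique A → Clique A → Set ℓ
Compatible {A = A} x x′ = IsClique A (⟦ x ⟧ ∪ ⟦ x′ ⟧)

singleton : (A : CoherenceSpace ℓ) → ∣ A ∣ → Clique A
singleton A α = record
  { ⟦_⟧      = α ≈_
  ; resp     = λ e p → ≈-trans p e
  ; coherent = λ p q → ∼-cong p q ∼-refl
  } where open CoherenceSpace A

_∩ᶜ_ : {A : CoherenceSpace ℓ} → Clique A → Clique A → Clique A
x ∩ᶜ x′ = record
  { ⟦_⟧      = ⟦ x ⟧ ∩ ⟦ x′ ⟧
  ; resp     = λ e (p , p′) → Clique.resp x e p , Clique.resp x′ e p′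
  ; coherent = λ (p , _) (q , _) → Clique.coherent x p q
  }

⋃ᶜ : {A : CoherenceSpace ℓ} (I : Set ℓ) (x : I → Clique A) →
     (∀ i j → Compatible (x i) (x j)) → Clique A
⋃ᶜ I x comp = record
  { ⟦_⟧      = ⋃[ i ∶ I ] ⟦ x i ⟧
  ; resp     = λ e (i , p) → i , Clique.resp (x i) e p
  ; coherent = λ (i , p) (j , q) → comp i j (inj₁ p) (inj₂ q)
  }

------------------------------------------------------------------------
-- Linear morphisms

record Linear (A B : CoherenceSpace ℓ) : Set (lsuc ℓ) where
  field
    apply      : Clique A → Clique B
    monotone   : ∀ {x x′} → ⟦ x ⟧ ⊆ ⟦ x′ ⟧ → ⟦ apply x ⟧ ⊆ ⟦ apply x′ ⟧
    ⋃-commutes : (I : Set ℓ) (x : I → Clique A) (comp : ∀ i j → Compatible (x i) (x j)) →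
                 ⟦ apply (⋃ᶜ I x comp) ⟧ ≐ ⋃[ i ∶ I ] ⟦ apply (x i) ⟧
    ∩-commutes : ∀ x x′ → Compatible x x′ →
                 ⟦ apply (x ∩ᶜ x′) ⟧ ≐ ⟦ apply x ⟧ ∩ ⟦ apply x′ ⟧

open Linear public using (apply)

Id : (A : CoherenceSpace ℓ) → Linear A A
Id A = record
  { apply      = λ x → x
  ; monotone   = λ s → s
  ; ⋃-commutes = λ I x comp → (λ p → p) , (λ p → p)
  ; ∩-commutes = λ x x′ comp → (λ p → p) , (λ p → p)
  }

infixr 9 _∘ₗ_

_∘ₗ_ : {A B C : CoherenceSpace ℓ} → Linear B C → Linear A B → Linear A C
_∘ₗ_ {A = A} {B} {C} G F = record
  { apply      = λ x → apply G (apply F x)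
  ; monotone   = λ s → G.monotone (F.monotone s)
  ; ⋃-commutes = λ I x comp →
      let (u , d) = F.⋃-commutes I x comp
          (u′ , d′) = G.⋃-commutes I (λ i → apply F (x i))
                        (λ i j → image-compatible (x i) (x j) (comp i j))
      in (λ p → u′ (G.monotone u p)) , (λ p → G.monotone d (d′ p))
  ; ∩-commutes = λ x x′ comp →
      let (u , d) = F.∩-commutes x x′ comp
          (u′ , d′) = G.∩-commutes (apply F x) (apply F x′) (image-compatible x x′ comp)
      in (λ p → u′ (G.monotone u p)) , (λ p → G.monotone d (d′ p))
  }
  where
  module F = Linear F
  module G = Linear G

  image-compatible : ∀ x x′ → Compatible x x′ → Compatible (apply F x) (apply F x′)
  image-compatible x x′ comp p q = Clique.coherent (apply F x∪x′) (into p) (into q)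
    where
    x∪x′ : Clique A
    x∪x′ = record
      { ⟦_⟧      = ⟦ x ⟧ ∪ ⟦ x′ ⟧
      ; resp     = λ { e (inj₁ r) → inj₁ (Clique.resp x e r)
                     ; e (inj₂ r) → inj₂ (Clique.resp x′ e r) }
      ; coherent = comp
      }
    into : ⟦ apply F x ⟧ ∪ ⟦ apply F x′ ⟧ ⊆ ⟦ apply F x∪x′ ⟧
    into (inj₁ r) = F.monotone inj₁ r
    into (inj₂ r) = F.monotone inj₂ r

infix 4 _≈ₗ_

_≈ₗ_ : {A B : CoherenceSpace ℓ} → Linear A B → Linear A B → Set (lsuc ℓ)
F ≈ₗ G = ∀ x → ⟦ apply F x ⟧ ≐ ⟦ apply G x ⟧

infixr 5 _⊸_

_⊸_ : CoherenceSpace ℓ → CoherenceSpace ℓ → CoherenceSpace ℓ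
A ⊸ B = record
  { web      = ×-setoid A.web B.web
  ; _∼_      = λ (α , β) (α′ , β′) → (α A.∼ α′ → β B.∼ β′) × (α A.⌢ α′ → β B.⌢ β′)
  ; ∼-refl   = (λ _ → B.∼-refl) , (λ (_ , ≉) → contradiction A.≈-refl ≉)
  ; ∼-sym    = λ (h , k) → (λ c → B.∼-sym (h (A.∼-sym c))) , (λ s → B.⌢-sym (k (A.⌢-sym s)))
  ; ∼-resp-≈ =
      (λ (e , e′) (h , k) → (λ c → B.∼-cong B.≈-refl e′ (h (A.∼-cong A.≈-refl (A.≈-sym e) c)))
                          , (λ s → B.⌢-cong B.≈-refl e′ (k (A.⌢-cong A.≈-refl (A.≈-sym e) s))))
    , (λ (e , e′) (h , k) → (λ c → B.∼-cong e′ B.≈-refl (h (A.∼-cong (A.≈-sym e) A.≈-refl c)))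
                          , (λ s → B.⌢-cong e′ B.≈-refl (k (A.⌢-cong (A.≈-sym e) A.≈-refl s))))
  }
  where
  module A = CoherenceSpace A
  module B = CoherenceSpace B

trace : {A B : CoherenceSpace ℓ} → Linear A B → Clique (A ⊸ B)
trace {ℓ} {A} {B} F = record
  { ⟦_⟧      = λ (α , β) → β ∈ ⟦ apply F (singleton A α) ⟧
  ; resp     = λ (e , e′) p →
      Clique.resp (apply F _) e′ (F.monotone (A.≈-trans (A.≈-sym e)) p)
  ; coherent = λ p q →
      (λ c → coh p q c)
    , (λ (c , ≉) → coh p q c , λ e → apart c ≉ (Clique.resp (apply F _) e p) q)
  }
  where
  module A = CoherenceSpace A
  module B = CoherenceSpace B
  module F = Linear F

  compatible : ∀ {α α′} → α A.∼ α′ → Compatible (singleton A α) (singleton A α′)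
  compatible c (inj₁ p) (inj₁ q) = A.∼-cong p q A.∼-refl
  compatible c (inj₁ p) (inj₂ q) = A.∼-cong p q c
  compatible c (inj₂ p) (inj₁ q) = A.∼-cong p q (A.∼-sym c)
  compatible c (inj₂ p) (inj₂ q) = A.∼-cong p q A.∼-refl

  coh : ∀ {α α′ β β′} → β ∈ ⟦ apply F (singleton A α) ⟧ →
        β′ ∈ ⟦ apply F (singleton A α′) ⟧ → α A.∼ α′ → β B.∼ β′
  coh {α} {α′} p q c =
    Clique.coherent (apply F pair) (F.monotone inj₁ p) (F.monotone inj₂ q)
    where
    pair : Clique A
    pair = record
      { ⟦_⟧      = (α A.≈_) ∪ (α′ A.≈_)
      ; resp     = λ { e (inj₁ r) → inj₁ (A.≈-trans r e)
                     ; e (inj₂ r) → inj₂ (A.≈-trans r e) }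
      ; coherent = compatible c
      }

  apart : ∀ {α α′ β} → α A.∼ α′ → ¬ (α A.≈ α′) →
          β ∈ ⟦ apply F (singleton A α) ⟧ → ¬ (β ∈ ⟦ apply F (singleton A α′) ⟧)
  apart {α} {α′} c ≉ p q =
    case proj₁ (F.⋃-commutes ⊥ (λ ()) (λ ()))
           (F.monotone (λ (r , s) → contradiction (A.≈-trans r (A.≈-sym s)) ≉)
             (proj₂ (F.∩-commutes (singleton A α) (singleton A α′) (compatible c)) (p , q)))
    of λ { (() , _) }

------------------------------------------------------------------------
-- Cantor space

2^ω : Set
2^ω = ℕ → Bool

infixr 5 _∷ω_ _++ω_

_∷ω_ : Bool → 2^ω → 2^ω
(b ∷ω w) zero    = b
(b ∷ω w) (suc n) = w n

_++ω_ : List Bool → 2^ω → 2^ω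
[]      ++ω w = w
(b ∷ m) ++ω w = b ∷ω (m ++ω w)

infix 4 _<ω_

_<ω_ : 2^ω → 2^ω → Set
w₁ <ω w₂ = ∃[ m ] ∃[ w₁′ ] ∃[ w₂′ ]
  (w₁ ≗ m ++ω (false ∷ω w₁′)) × (w₂ ≗ m ++ω (true ∷ω w₂′))

-- Openness for the product topology: the words sharing a given finite
-- prefix form a basis.

IsOpen : Pred 2^ω ℓ → Set ℓ
IsOpen U = ∀ w → w ∈ U → ∃[ n ] (∀ w′ → (∀ i → i < n → w i ≡ w′ i) → w′ ∈ U)

-- The singletons form a basis of the discrete topology; see
-- continuous⇒preimage-open for the preimages of arbitrary subsets.

IsContinuous : (S : Setoid ℓ ℓ) → Func (ℕ →-setoid Bool) S → Set ℓ
IsContinuous S f = ∀ a → IsOpen (λ w → Func.to f w ≈ a)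
  where open Setoid S

continuous⇒preimage-open :
  ∀ {p} (S : Setoid ℓ ℓ) (f : Func (ℕ →-setoid Bool) S) → IsContinuous S f →
  (U : Pred (Setoid.Carrier S) p) → U Respects (Setoid._≈_ S) →
  IsOpen (λ w → Func.to f w ∈ U)
continuous⇒preimage-open S f cont U resp w p =
  let (n , h) = cont (Func.to f w) w (Setoid.refl S)
  in n , λ w′ e → resp (Setoid.sym S (h w′ e)) p

record ContinuousMap (S : Setoid ℓ ℓ) : Set ℓ where
  field
    func       : Func (ℕ →-setoid Bool) S
    continuous : IsContinuous S func

  open Func func public using () renaming (to to at)

open ContinuousMap public using (at)

------------------------------------------------------------------------
-- The coherence space flag A

module _ (A : CoherenceSpace ℓ) where
  open CoherenceSpace A

  flagWeb : Setoid ℓ ℓ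
  flagWeb = record
    { Carrier       = ContinuousMap web
    ; _≈_           = λ f g → ∀ w → at f w ≈ at g w
    ; isEquivalence = record
      { refl  = λ w → ≈-refl
      ; sym   = λ e w → ≈-sym (e w)
      ; trans = λ e e′ w → ≈-trans (e w) (e′ w)
      }
    }

  private module W = Setoid flagWeb

  EqualBelow : 2^ω → Rel (ContinuousMap web) ℓ
  EqualBelow w f g = ∀ w′ → w′ <ω w → at f w′ ≈ at g w′

  FlagStrict : Rel (ContinuousMap web) ℓ
  FlagStrict f g = ∃[ w ] (at f w ⌢ at g w × EqualBelow w f g)

  -- The definition of flag A prescribes its strict coherence, FlagStrict, so
  -- that coherence is classically "f ≈ g or FlagStrict f g".  Constructively
  -- that disjunction would also assert that equality of coherent maps is
  -- decidable.  The relation below avoids this: its strict part is exactly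
  -- FlagStrict (flag-⌢), and it is the disjunction as soon as equality in
  -- the web of A is decidable (flag-∼), as it always is classically.

  FlagCoherent : Rel (ContinuousMap web) ℓ
  FlagCoherent f g =
    ∃[ w ] (at f w ∼ at g w × EqualBelow w f g × (at f w ≈ at g w → f W.≈ g))

  flag : CoherenceSpace ℓ
  flag = record
    { web      = flagWeb
    ; _∼_      = FlagCoherent
    ; ∼-refl   = (λ _ → false) , ∼-refl , (λ _ _ → ≈-refl) , (λ _ _ → ≈-refl)
    ; ∼-sym    = λ (w , c , b , h) →
        w , ∼-sym c , (λ w′ l → ≈-sym (b w′ l)) , (λ e v → ≈-sym (h (≈-sym e) v))
    ; ∼-resp-≈ =
        (λ q (w , c , b , h) →
            w , ∼-cong ≈-refl (q w) c , (λ w′ l → ≈-trans (b w′ l) (q w′))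
          , (λ e v → ≈-trans (h (≈-trans e (≈-sym (q w))) v) (q v)))
      , (λ q (w , c , b , h) →
            w , ∼-cong (q w) ≈-refl c , (λ w′ l → ≈-trans (≈-sym (q w′)) (b w′ l))
          , (λ e v → ≈-trans (≈-sym (q v)) (h (≈-trans (q w) e) v)))
    }

  flag-⌢ : ∀ f g → CoherenceSpace._⌢_ flag f g ⇔ FlagStrict f g
  flag-⌢ f g = mk⇔
    (λ ((w , c , b , h) , ≉) → w , (c , λ e → ≉ (h e)) , b)
    (λ (w , (c , ≉) , b) → (w , c , b , λ e → contradiction e ≉) , λ q → ≉ (q w))

  flag-∼ : Decidable _≈_ → ∀ f g →
           CoherenceSpace._∼_ flag f g ⇔ (f W.≈ g ⊎ FlagStrict f g)
  flag-∼ _≟_ f g = mk⇔ to from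
    where
    module F = CoherenceSpace flag

    to : f F.∼ g → f W.≈ g ⊎ FlagStrict f g
    to (w , c , b , h) with at f w ≟ at g w
    ... | yes e = inj₁ (h e)
    ... | no ≉  = inj₂ (w , (c , ≉) , b)

    from : f W.≈ g ⊎ FlagStrict f g → f F.∼ g
    from (inj₁ q)                  = F.∼-cong {f} {f} {f} {g} (λ _ → ≈-refl) q (F.∼-refl {f})
    from (inj₂ (w , (c , ≉) , b)) = w , c , b , λ e → contradiction e ≉

{-# OPTIONS --safe #-}

-- The trace {(α , const α) | α ∈ |A|} and its converse both define linear
-- morphisms.  The point is that const α and const α′ are coherent exactly when
-- α and α′ are: the least word 000… has nothing below it, so it witnesses the
-- coherence of the constants; conversely any witness w gives α ∼ α′ there.

module Submission where

open import Defs
open import Data.Bool.Base using (false; true)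
open import Data.List.Base using ([]; _∷_)
open import Data.Nat.Base using (suc)
open import Data.Product.Base using (Σ-syntax; ∃-syntax; _×_; _,_)
open import Data.Sum.Base using (inj₁; inj₂)
open import Function.Base using (const; flip)
open import Level using (Level)
open import Relation.Binary.Core using (REL)
open import Relation.Binary.Definitions using (_Respectsʳ_)
open import Relation.Binary.PropositionalEquality using (_≗_)
open import Relation.Nullary.Negation.Core using (¬_; contradiction)
open import Relation.Unary using (_∈_; _⊆_)

private
  variable
    ℓ : Level

-- A clique of A ⊸ B only yields ¬ ¬ (α ≈ α′) when α ∼ α′ are both related to
-- the same β; preservation of intersections needs α ≈ α′ itself.
record IsLinearTrace (A B : CoherenceSpace ℓ) (R : REL ∣ A ∣ ∣ B ∣ ℓ) : Set ℓ where
  private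
    module A = CoherenceSpace A
    module B = CoherenceSpace B
  field
    respʳ     : R Respectsʳ B._≈_
    coherent  : ∀ {α α′ β β′} → α A.∼ α′ → R α β → R α′ β′ → β B.∼ β′
    injective : ∀ {α α′ β} → α A.∼ α′ → R α β → R α′ β → α A.≈ α′

fromTrace : {A B : CoherenceSpace ℓ} {R : REL ∣ A ∣ ∣ B ∣ ℓ} →
            IsLinearTrace A B R → Linear A B
fromTrace {A = A} {B} {R} isTrace = record
  { apply      = λ x → record
    { ⟦_⟧      = λ β → ∃[ α ] (α ∈ ⟦ x ⟧ × R α β)
    ; resp     = λ e (α , p , r) → α , p , respʳ e r
    ; coherent = λ (_ , p , r) (_ , q , s) → coherent (Clique.coherent x p q) r s
    }
  ; monotone   = λ s (α , p , r) → α , s p , r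
  ; ⋃-commutes = λ I x comp →
      (λ (α , (i , p) , r) → i , α , p , r) , (λ (i , α , p , r) → α , (i , p) , r)
  ; ∩-commutes = λ x x′ comp →
      (λ (α , (p , p′) , r) → (α , p , r) , (α , p′ , r))
    , (λ ((α , p , r) , (α′ , p′ , r′)) →
        -- `α` and `α′` lie in compatible cliques, so they are coherent; sharing the image `β`, they
        -- are equal, which moves `p′` from `α′` to `α`.
        α , (p , Clique.resp x′ (A.≈-sym (injective (comp (inj₁ p) (inj₂ p′)) r r′)) p′) , r)
  }
  where
  open IsLinearTrace isTrace
  module A = CoherenceSpace A

0^ω : 2^ω
0^ω = const false

-- The larger of two words carries a 1 where they first differ, and `0^ω` has no 1.
0^ω-minimal : ∀ w → ¬ (w <ω 0^ω)
0^ω-minimal _ (m , _ , w₂ , _ , e) = 0^ω≭m1w₂ m e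
  where
  0^ω≭m1w₂ : ∀ m → ¬ (0^ω ≗ m ++ω (true ∷ω w₂))
  0^ω≭m1w₂ []      e = contradiction (e 0) λ ()
  0^ω≭m1w₂ (_ ∷ m) e = 0^ω≭m1w₂ m (λ n → e (suc n))

module _ (A : CoherenceSpace ℓ) where
  open CoherenceSpace A
  private module F = CoherenceSpace (flag A)

  constant : ∣ A ∣ → ∣ flag A ∣
  constant α = record
    { func       = record { to = const α ; cong = const ≈-refl }
    ; continuous = λ a w e → 0 , λ _ _ → e
    }

  IsConstant : REL ∣ A ∣ ∣ flag A ∣ ℓ
  IsConstant α g = constant α F.≈ g

  isConstant-isLinearTrace : IsLinearTrace A (flag A) IsConstant
  isConstant-isLinearTrace = record
    { respʳ     = λ e r w → ≈-trans (r w) (e w)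
    ; coherent  = λ c r s →
        0^ω , ∼-cong (r 0^ω) (s 0^ω) c
      , (λ w l → contradiction l (0^ω-minimal w))
      -- Both maps are constant, so agreement at `0^ω` spreads to every word `w`.
      , λ e w → ≈-trans (≈-sym (r w))
                  (≈-trans (≈-trans (r 0^ω) (≈-trans e (≈-sym (s 0^ω)))) (s w))
    ; injective = λ _ r s → ≈-trans (r 0^ω) (≈-sym (s 0^ω))
    }

  isConstant-converse-isLinearTrace : IsLinearTrace (flag A) A (flip IsConstant)
  isConstant-converse-isLinearTrace = record
    { respʳ     = λ e r w → ≈-trans (≈-sym e) (r w)
    ; coherent  = λ (w , c , _) r s → ∼-cong (≈-sym (r w)) (≈-sym (s w)) c
    ; injective = λ _ r s w → ≈-trans (≈-sym (r w)) (s w)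
    }

proposition18 : ∀ {ℓ} (A : CoherenceSpace ℓ) →
    Σ[ f ∈ Linear A (flag A) ] Σ[ t ∈ Linear (flag A) A ]
    ((t ∘ₗ f ≈ₗ Id A) × (⟦ trace (f ∘ₗ t) ⟧ ⊆ ⟦ trace (Id (flag A)) ⟧))
proposition18 A =
    fromTrace (isConstant-isLinearTrace A)
  , fromTrace (isConstant-converse-isLinearTrace A)
  , (λ x →
        -- `g` is constant with both values; evaluating it at `0^ω` identifies them.
        (λ (g , (α , p , r) , s) → Clique.resp x (≈-trans (r 0^ω) (≈-sym (s 0^ω))) p)
      , (λ {α} p → constant A α , (α , p , λ _ → ≈-refl) , λ _ → ≈-refl))
  -- Both maps of the pair equal `constant α`. A non-constant map is related to no token, hence an
  -- inclusion only.
  , λ (α , (g , e , r) , s) w → ≈-trans (e w) (≈-trans (≈-sym (r w)) (s w))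
  where open CoherenceSpace A
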